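{- Let $\mathsf v=\mathsf v_1\cdots\mathsf v_s$ be a strictly decreasing word ($\mathsf v_1>\cdots>\mathsf v_s$) and $\mathsf w=\mathsf w_1\cdots\mathsf w_t$ a strictly increasing word in $\{1,\dots,N\}$, and let $b$ satisfy $\mathsf v_1<b<\mathsf w_1$. Then $u_b\mathbf u_{\mathsf v}\mathbf u_{\mathsf w}\equiv u_b\mathbf u_{\mathsf w}\mathbf u_{\mathsf v}\pmod{I_{\mathrm B}}$.
   Context: $\mathcal U=\mathbb Z\langle u_1,\dots,u_N\rangle$ is the free associative ring on noncommuting generators, $\mathbf u_{\mathsf w}=u_{\mathsf w_1}\cdots u_{\mathsf w_n}$. $I_{\mathrm B}$ is the two-sided ideal generated by $u_b^2u_a+u_au_bu_a-u_bu_au_b-u_bu_a^2$ ($a<b$), $u_bu_cu_a-u_bu_au_c$ ($a<b<c$), $u_au_cu_b-u_cu_au_b$ ($a<b<c$). -}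

module Defs where

open import Data.Nat using (ℕ)
open import Data.Fin using (Fin; _<_; _>_)
import Data.Fin as Fin
open import Data.Integer using (ℤ; _+_; _*_; -_; 0ℤ; 1ℤ)
open import Data.List using (List; []; _∷_; _++_; map; concatMap; [_])
import Data.List.Properties as LP
open import Data.Product using (_×_; _,_)
open import Relation.Nullary using (yes; no)
open import Relation.Binary.PropositionalEquality using (_≡_)

-- Words in the alphabet {1,…,N}, encoded as Fin N (0-indexed, same order).
Word : ℕ → Set
Word N = List (Fin N)

-- An element of the free associative ring ℤ⟨u_1,…,u_N⟩, written as a
-- finite formal ℤ-linear combination of words (not necessarily normalised).
Poly : ℕ → Set
Poly N = List (ℤ × Word N)

module _ {N : ℕ} where

  _≟w_ : (x y : Word N) → Relation.Nullary.Dec (x ≡ y)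
  _≟w_ = LP.≡-dec Fin._≟_

  coeff : Poly N → Word N → ℤ
  coeff [] w = 0ℤ
  coeff ((c , x) ∷ p) w with x ≟w w
  ... | yes _ = c + coeff p w
  ... | no _  = coeff p w

  -- two representations denote the same ring element iff all coefficients agree
  _≈P_ : Poly N → Poly N → Set
  p ≈P q = ∀ w → coeff p w ≡ coeff q w

  infixr 6 _⊕_
  infix 8 ⊖_
  infixl 7 _⊛_
  infix 4 _≡_mod-IB

  _⊕_ : Poly N → Poly N → Poly N
  p ⊕ q = p ++ q

  ⊖_ : Poly N → Poly N
  ⊖ p = map (λ { (c , x) → (- c , x) }) p

  _⊛_ : Poly N → Poly N → Poly N
  p ⊛ q = concatMap (λ { (c , x) → map (λ { (d , y) → (c * d , x ++ y) }) q }) p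

  𝐮 : Word N → Poly N
  𝐮 w = [ (1ℤ , w) ]

  data GenB : Poly N → Set where
    gen1 : (a b : Fin N) → a < b →
      GenB (𝐮 (b ∷ b ∷ a ∷ []) ⊕ 𝐮 (a ∷ b ∷ a ∷ [])
             ⊕ ⊖ (𝐮 (b ∷ a ∷ b ∷ []) ⊕ 𝐮 (b ∷ a ∷ a ∷ [])))
    gen2 : (a b c : Fin N) → a < b → b < c →
      GenB (𝐮 (b ∷ c ∷ a ∷ []) ⊕ ⊖ 𝐮 (b ∷ a ∷ c ∷ []))
    gen3 : (a b c : Fin N) → a < b → b < c →
      GenB (𝐮 (a ∷ c ∷ b ∷ []) ⊕ ⊖ 𝐮 (c ∷ a ∷ b ∷ []))

  data InIB : Poly N → Set where
    zeroI : InIB []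
    genI  : (x y g : Poly N) → GenB g → InIB ((x ⊛ g) ⊛ y)
    addI  : {p q : Poly N} → InIB p → InIB q → InIB (p ⊕ q)
    respI : {p q : Poly N} → p ≈P q → InIB p → InIB q

  _≡_mod-IB : Poly N → Poly N → Set
  p ≡ q mod-IB = InIB (p ⊕ ⊖ q)

-- Only the generator u_b u_c u_a − u_b u_a u_c (a < b < c) is needed; it lets the word
-- p x y rewrite to p y x whenever x < p < y. If p ∷ w is increasing and x < p, then x
-- travels through w to its end, each letter of w serving in turn as the pivot p. Doing
-- this for the letters of the decreasing word v, the last one first, moves all of v
-- past w; the hypothesis v₁ < b < w₁ makes b the pivot needed for the first step.
module Submission where

open import Defs
open import Data.Nat using (ℕ)
open import Data.Fin using (Fin; _<_; _>_)
import Data.Fin.Properties as FinP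
open import Data.List using (List; []; _∷_; _++_; [_]; map)
import Data.List.Properties as ListP
open import Data.List.Relation.Unary.Linked using (Linked; []; [-]; _∷_)
open import Data.Product using (_,_)
open import Data.Integer using (ℤ; 0ℤ) renaming (_+_ to _+ℤ_; -_ to -ℤ_; _*_ to _*ℤ_)
import Data.Integer.Properties as ℤP
open import Data.Integer.Tactic.RingSolver using (solve-∀)
open import Level using (0ℓ)
open import Relation.Nullary using (yes; no)
open import Relation.Binary.Core using (Rel; _=[_]⇒_)
open import Relation.Binary.Structures using (IsEquivalence)
open import Relation.Binary.Construct.Closure.Equivalence using (EqClosure; gmap; gfold)
open import Relation.Binary.Construct.Closure.ReflexiveTransitive using (ε; _◅_; _◅◅_)
open import Relation.Binary.Construct.Closure.Symmetric using (bwd)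
open import Relation.Binary.PropositionalEquality
  using (_≡_; refl; sym; trans; cong; cong₂; subst; subst₂; module ≡-Reasoning)

module _ {N : ℕ} where

  coeff-++ : (p q : Poly N) (w : Word N) → coeff (p ++ q) w ≡ coeff p w +ℤ coeff q w
  coeff-++ []            q w = sym (ℤP.+-identityˡ _)
  coeff-++ ((c , x) ∷ p) q w with x ≟w w
  ... | yes _ = trans (cong (c +ℤ_) (coeff-++ p q w)) (sym (ℤP.+-assoc c _ _))
  ... | no _  = coeff-++ p q w

  coeff-⊖ : (p : Poly N) (w : Word N) → coeff (⊖ p) w ≡ -ℤ coeff p w
  coeff-⊖ []            w = refl
  coeff-⊖ ((c , x) ∷ p) w with x ≟w w
  ... | yes _ = trans (cong (-ℤ c +ℤ_) (coeff-⊖ p w)) (sym (ℤP.neg-distrib-+ c _))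
  ... | no _  = coeff-⊖ p w

  coeff-⊕⊖ : (p q : Poly N) (w : Word N) → coeff (p ⊕ ⊖ q) w ≡ coeff p w +ℤ -ℤ coeff q w
  coeff-⊕⊖ p q w = trans (coeff-++ p (⊖ q) w) (cong (coeff p w +ℤ_) (coeff-⊖ q w))

  ⊖-⊛ : (p q : Poly N) → ⊖ (p ⊛ q) ≡ ⊖ p ⊛ q
  ⊖-⊛ []            q = refl
  ⊖-⊛ ((c , x) ∷ p) q =
    trans (ListP.map-++ _ (scale c q) (p ⊛ q)) (cong₂ _++_ (⊖-scale q) (⊖-⊛ p q))
    where
    scale : ℤ → Poly N → Poly N
    scale c = map (λ { (d , y) → (c *ℤ d , x ++ y) })

    ⊖-scale : (q : Poly N) → ⊖ scale c q ≡ scale (-ℤ c) q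
    ⊖-scale []            = refl
    ⊖-scale ((d , y) ∷ q) = cong₂ _∷_ (cong (_, x ++ y) (ℤP.neg-distribˡ-* c d)) (⊖-scale q)

  InIB-⊖ : {p : Poly N} → InIB p → InIB (⊖ p)
  InIB-⊖ zeroI = zeroI
  InIB-⊖ (genI x y g G) =
    subst InIB (sym (trans (⊖-⊛ (x ⊛ g) y) (cong (_⊛ y) (⊖-⊛ x g)))) (genI (⊖ x) y g G)
  InIB-⊖ (addI {p} {q} p∈I q∈I) =
    subst InIB (sym (ListP.map-++ _ p q)) (addI (InIB-⊖ p∈I) (InIB-⊖ q∈I))
  InIB-⊖ (respI {p} {q} p≈q p∈I) = respI coeff-eq (InIB-⊖ p∈I)
    where
    coeff-eq : (⊖ p) ≈P (⊖ q)
    coeff-eq w = trans (coeff-⊖ p w) (trans (cong -ℤ_ (p≈q w)) (sym (coeff-⊖ q w)))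

  mod-IB-isEquivalence : IsEquivalence (_≡_mod-IB {N})
  mod-IB-isEquivalence = record
    { refl  = λ {p} → mod-refl {p}
    ; sym   = λ {p q} → mod-sym {p} {q}
    ; trans = λ {p q r} → mod-trans {p} {q} {r}
    }
    where
    mod-refl : {p : Poly N} → p ≡ p mod-IB
    mod-refl {p} = respI (λ w → trans (lemma (coeff p w)) (sym (coeff-⊕⊖ p p w))) zeroI
      where
      lemma : ∀ a → 0ℤ ≡ a +ℤ -ℤ a
      lemma = solve-∀

    mod-sym : {p q : Poly N} → p ≡ q mod-IB → q ≡ p mod-IB
    mod-sym {p} {q} p≡q = respI coeff-eq (InIB-⊖ p≡q)
      where
      lemma : ∀ a b → -ℤ (a +ℤ -ℤ b) ≡ b +ℤ -ℤ a
      lemma = solve-∀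

      coeff-eq : (⊖ (p ⊕ ⊖ q)) ≈P (q ⊕ ⊖ p)
      coeff-eq w = begin
        coeff (⊖ (p ⊕ ⊖ q)) w             ≡⟨ coeff-⊖ (p ⊕ ⊖ q) w ⟩
        -ℤ coeff (p ⊕ ⊖ q) w              ≡⟨ cong -ℤ_ (coeff-⊕⊖ p q w) ⟩
        -ℤ (coeff p w +ℤ -ℤ coeff q w)    ≡⟨ lemma (coeff p w) (coeff q w) ⟩
        coeff q w +ℤ -ℤ coeff p w         ≡⟨ coeff-⊕⊖ q p w ⟨
        coeff (q ⊕ ⊖ p) w                 ∎
        where open ≡-Reasoning

    mod-trans : {p q r : Poly N} → p ≡ q mod-IB → q ≡ r mod-IB → p ≡ r mod-IB
    mod-trans {p} {q} {r} p≡q q≡r = respI coeff-eq (addI p≡q q≡r)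
      where
      lemma : ∀ a b c → (a +ℤ -ℤ b) +ℤ (b +ℤ -ℤ c) ≡ a +ℤ -ℤ c
      lemma = solve-∀

      coeff-eq : ((p ⊕ ⊖ q) ⊕ (q ⊕ ⊖ r)) ≈P (p ⊕ ⊖ r)
      coeff-eq w = begin
        coeff ((p ⊕ ⊖ q) ⊕ (q ⊕ ⊖ r)) w                          ≡⟨ coeff-++ (p ⊕ ⊖ q) (q ⊕ ⊖ r) w ⟩
        coeff (p ⊕ ⊖ q) w +ℤ coeff (q ⊕ ⊖ r) w                   ≡⟨ cong₂ _+ℤ_ (coeff-⊕⊖ p q w) (coeff-⊕⊖ q r w) ⟩
        (coeff p w +ℤ -ℤ coeff q w) +ℤ (coeff q w +ℤ -ℤ coeff r w) ≡⟨ lemma (coeff p w) (coeff q w) (coeff r w) ⟩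
        coeff p w +ℤ -ℤ coeff r w                                 ≡⟨ coeff-⊕⊖ p r w ⟨
        coeff (p ⊕ ⊖ r) w                                         ∎
        where open ≡-Reasoning

  data Swap : Rel (Word N) 0ℓ where
    swap : (l r : Word N) {a b c : Fin N} → a < b → b < c →
           Swap (l ++ b ∷ c ∷ a ∷ r) (l ++ b ∷ a ∷ c ∷ r)

  swap-sound : Swap =[ 𝐮 ]⇒ _≡_mod-IB
  swap-sound (swap l r {a} {b} {c} a<b b<c) =
    subst InIB product≡ (genI (𝐮 l) (𝐮 r) _ (gen2 a b c a<b b<c))
    where
    product≡ : (𝐮 l ⊛ (𝐮 (b ∷ c ∷ a ∷ []) ⊕ ⊖ 𝐮 (b ∷ a ∷ c ∷ []))) ⊛ 𝐮 r
               ≡ 𝐮 (l ++ b ∷ c ∷ a ∷ r) ⊕ ⊖ 𝐮 (l ++ b ∷ a ∷ c ∷ r)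
    product≡ rewrite ListP.++-assoc l (b ∷ c ∷ a ∷ []) r
                   | ListP.++-assoc l (b ∷ a ∷ c ∷ []) r = refl

  swap-∷ : (x : Fin N) {P Q : Word N} → Swap P Q → Swap (x ∷ P) (x ∷ Q)
  swap-∷ x (swap l r a<b b<c) = swap (x ∷ l) r a<b b<c

  swap-++ : (v : Word N) {P Q : Word N} → Swap P Q → Swap (P ++ v) (Q ++ v)
  swap-++ v (swap l r {a} {b} {c} a<b b<c) =
    subst₂ Swap (reassoc (b ∷ c ∷ a ∷ [])) (reassoc (b ∷ a ∷ c ∷ [])) (swap l (r ++ v) a<b b<c)
    where
    reassoc : (m : Word N) → l ++ m ++ r ++ v ≡ (l ++ m ++ r) ++ v
    reassoc m = sym (trans (ListP.++-assoc l (m ++ r) v) (cong (l ++_) (ListP.++-assoc m r v)))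

  infix 4 _≈B_

  _≈B_ : Rel (Word N) 0ℓ
  _≈B_ = EqClosure Swap

  ≈B-sound : _≈B_ =[ 𝐮 ]⇒ _≡_mod-IB
  ≈B-sound = gfold mod-IB-isEquivalence 𝐮 swap-sound

  ≈B-∷ : (x : Fin N) {P Q : Word N} → P ≈B Q → x ∷ P ≈B x ∷ Q
  ≈B-∷ x = gmap (x ∷_) (swap-∷ x)

  ≈B-++ : (v : Word N) {P Q : Word N} → P ≈B Q → P ++ v ≈B Q ++ v
  ≈B-++ v = gmap (_++ v) (swap-++ v)

  Linked-<-lowerHead : {x p : Fin N} (w : Word N) → x < p → Linked _<_ (p ∷ w) → Linked _<_ (x ∷ w)
  Linked-<-lowerHead []      x<p _            = [-]
  Linked-<-lowerHead (y ∷ w) x<p (p<y ∷ y∷w↑) = FinP.<-trans x<p p<y ∷ y∷w↑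

  push-through-increasing : (p x : Fin N) (w : Word N) → x < p → Linked _<_ (p ∷ w) →
                            p ∷ x ∷ w ≈B p ∷ w ++ [ x ]
  push-through-increasing p x []      x<p _            = ε
  push-through-increasing p x (y ∷ w) x<p (p<y ∷ y∷w↑) =
    bwd (swap [] w x<p p<y) ◅ ≈B-∷ p (push-through-increasing y x w (FinP.<-trans x<p p<y) y∷w↑)

  decreasing-increasing-commute : (p : Fin N) (v w : Word N) →
    Linked _>_ (p ∷ v) → Linked _<_ (p ∷ w) → p ∷ v ++ w ≈B p ∷ w ++ v
  decreasing-increasing-commute p []      w _            _      =
    subst (λ z → p ∷ w ≈B p ∷ z) (sym (ListP.++-identityʳ w)) ε
  decreasing-increasing-commute p (x ∷ v) w (p>x ∷ x∷v↓) p∷w↑ =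
    ≈B-∷ p (decreasing-increasing-commute x v w x∷v↓ (Linked-<-lowerHead w p>x p∷w↑))
    ◅◅ subst (λ z → p ∷ x ∷ w ++ v ≈B p ∷ z) (ListP.++-assoc w [ x ] v)
             (≈B-++ v (push-through-increasing p x w p>x p∷w↑))

lemma9p8 : {N : ℕ} (v₁ : Fin N) (vs : List (Fin N)) (w₁ : Fin N) (ws : List (Fin N)) (b : Fin N)
    → Linked _>_ (v₁ ∷ vs) → Linked _<_ (w₁ ∷ ws) → v₁ < b → b < w₁
    → (𝐮 (b ∷ ((v₁ ∷ vs) ++ (w₁ ∷ ws)))) ≡ (𝐮 (b ∷ ((w₁ ∷ ws) ++ (v₁ ∷ vs)))) mod-IB
lemma9p8 v₁ vs w₁ ws b v↓ w↑ v₁<b b<w₁ =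
  ≈B-sound (decreasing-increasing-commute b (v₁ ∷ vs) (w₁ ∷ ws) (v₁<b ∷ v↓) (b<w₁ ∷ w↑))
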